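{- Discounted Markov decision processes reduce to their binary counterparts in strongly polynomial time. That is, there is a strongly polynomial procedure that transforms every discounted MDP into a binary discounted MDP (one in which every state has at most two actions), such that from a solution (optimal policy) of the binary MDP an optimal policy of the original MDP can be computed in strongly polynomial time.
   Context: Write $[n]=\{1,\dots,n\}$. A discounted MDP has $n$ states; in state $j\in[n]$ there are $a_j\ge1$ actions; choosing action $i\in[a_j]$ in state $j$ gives reward $r^j_i\in\mathbb R$ and moves the process to state $k$ with probability $p^j_{ik}\in[0,1]$, where $\sum_k p^j_{ik}=1$; rewards are discounted by a factor $\gamma\in[0,1)$ over an infinite-time horizon. A policy $\pi$ assigns to each state $j$ an action $\pi(j)\in[a_j]$. The Bellman equations $v_j=\max_{i\in[a_j]}\{r^j_i+\gamma\sum_{k=1}^n p^j_{ik}v_k\}$, $j\in[n]$, have a unique solution $v^*$; a policy is optimal iff for every $j$ the action $\pi(j)$ attains the maximum at $v=v^*$. A procedure is strongly polynomial if its number of arithmetic operations (including comparisons) is bounded by a polynomial in the number of states and the total number of actions. -}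

module Defs where

open import Algebra.Bundles using (CommutativeRing)
open import Data.Fin using (Fin)
open import Data.Nat as ℕ using (ℕ; suc; _⊔_)
open import Data.Nat.Properties using (+-0-monoid)
open import Data.Nat.Solver using (module +-*-Solver)
open import Data.Product using (Σ; ∃; _×_; _,_; proj₁; proj₂)
open import Data.Sum using (_⊎_; [_,_]′)
open import Data.Empty using (⊥)
import Data.Vec as Vec
open import Data.Vec.Functional using (Vector; _∷_; [])
open import Level using () renaming (suc to lsuc; _⊔_ to _⊔ˡ_)
open import Relation.Binary using (Rel; IsDecTotalOrder)
open import Relation.Nullary using (¬_; yes; no)
import Algebra.Properties.Monoid.Sum as MonoidSum
import Relation.Binary.Construct.NonStrictToStrict as ToStrict

-- The real numbers enter only through their ordered-field structure, together
-- with the exact comparisons of the real-number model of computation.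
-- Division is total; dividing by zero gives an unspecified element.

record OrderedField c ℓ₁ ℓ₂ : Set (lsuc (c ⊔ˡ ℓ₁ ⊔ˡ ℓ₂)) where
  infix  4 _≤_
  infix  8 _⁻¹
  field
    commutativeRing : CommutativeRing c ℓ₁
  open CommutativeRing commutativeRing public
  field
    _⁻¹             : Carrier → Carrier
    _≤_             : Rel Carrier ℓ₂
    0≉1             : ¬ (0# ≈ 1#)
    ⁻¹-inverseʳ     : ∀ x → ¬ (x ≈ 0#) → x * x ⁻¹ ≈ 1#
    isDecTotalOrder : IsDecTotalOrder _≈_ _≤_
    +-monoˡ-≤       : ∀ z {x y} → x ≤ y → x + z ≤ y + z
    *-nonneg        : ∀ {x y} → 0# ≤ x → 0# ≤ y → 0# ≤ x * y

  open IsDecTotalOrder isDecTotalOrder public using (_≤?_)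
  open ToStrict _≈_ _≤_ public using (_<_)
  open MonoidSum +-monoid public using (sum)

------------------------------------------------------------------------
-- Markov decision processes

record Shape : Set where
  field
    states    : ℕ
    actions   : Fin states → ℕ
    actions≥1 : ∀ j → 1 ℕ.≤ actions j

  totalActions : ℕ
  totalActions = MonoidSum.sum +-0-monoid actions

open Shape public

IsBinary : Shape → Set
IsBinary S = ∀ j → actions S j ℕ.≤ 2

Policy : Shape → Set
Policy S = (j : Fin (states S)) → Fin (actions S j)

data Entry (S : Shape) : Set where
  discount    : Entry S
  reward      : (j : Fin (states S)) → Fin (actions S j) → Entry S
  probability : (j : Fin (states S)) → Fin (actions S j) → Fin (states S) → Entry S

module MDP {c ℓ₁ ℓ₂} (F : OrderedField c ℓ₁ ℓ₂) where
  open OrderedField F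

  record IsDiscountedMDP (S : Shape) (d : Entry S → Carrier) : Set (ℓ₁ ⊔ˡ ℓ₂) where
    field
      discount≥0      : 0# ≤ d discount
      discount<1      : d discount < 1#
      probability≥0   : ∀ j i k → 0# ≤ d (probability j i k)
      probability≤1   : ∀ j i k → d (probability j i k) ≤ 1#
      probability-sum : ∀ j i → sum (λ k → d (probability j i k)) ≈ 1#

  _IsMaximumOf_ : ∀ {m} → Carrier → (Fin m → Carrier) → Set (ℓ₁ ⊔ˡ ℓ₂)
  x IsMaximumOf f = (∃ λ i → x ≈ f i) × (∀ i → f i ≤ x)

  actionValue : (S : Shape) (d : Entry S → Carrier) → (Fin (states S) → Carrier) →
                (j : Fin (states S)) → Fin (actions S j) → Carrier
  actionValue S d v j i =
    d (reward j i) + d discount * sum (λ k → d (probability j i k) * v k)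

  SolvesBellman : (S : Shape) (d : Entry S → Carrier) → (Fin (states S) → Carrier) →
                  Set (ℓ₁ ⊔ˡ ℓ₂)
  SolvesBellman S d v = ∀ j → v j IsMaximumOf actionValue S d v j

  -- For a discounted MDP the Bellman equations have exactly one solution, so
  -- the field v* is determined by the MDP up to _≈_.
  record IsOptimal (S : Shape) (d : Entry S → Carrier) (π : Policy S) :
                   Set (c ⊔ˡ ℓ₁ ⊔ˡ ℓ₂) where
    field
      v*      : Fin (states S) → Carrier
      bellman : SolvesBellman S d v*
      attains : ∀ j → actionValue S d v* j (π j) IsMaximumOf actionValue S d v* j

------------------------------------------------------------------------
-- Arithmetic procedures

data Operation (V : Set) : Set where
  zero′ one′          : Operation V
  _⊕_ _⊖_ _⊗_ _⊘_     : V → V → Operation V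

-- An algebraic computation tree: X names the numbers in the input and Fin k
-- (most recent first) the results computed so far.  A numeric operation
-- appends a result; the two subtrees of a comparison x ≤ y are for the answers
-- yes and no.  A leaf gives a discrete result l and, for each element of P l,
-- the operand holding that number.  Numbers can be accessed in no other way, so
-- a tree does not depend on the field it is run over.

data Program (X : Set) (L : Set) (P : L → Set) (k : ℕ) : Set where
  return  : (l : L) → (P l → X ⊎ Fin k) → Program X L P k
  compute : Operation (X ⊎ Fin k) → Program X L P (suc k) → Program X L P k
  compare : (x y : X ⊎ Fin k) → (yes-tree no-tree : Program X L P k) → Program X L P k

operations : ∀ {X L P k} → Program X L P k → ℕ
operations (return _ _)      = 0
operations (compute _ t)     = suc (operations t)
operations (compare _ _ t u) = suc (operations t ⊔ operations u)

module Semantics {c ℓ₁ ℓ₂} (F : OrderedField c ℓ₁ ℓ₂) where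
  open OrderedField F

  ⟦_⟧ᵒ : ∀ {V} → Operation V → (V → Carrier) → Carrier
  ⟦ zero′ ⟧ᵒ ρ = 0#
  ⟦ one′  ⟧ᵒ ρ = 1#
  ⟦ x ⊕ y ⟧ᵒ ρ = ρ x + ρ y
  ⟦ x ⊖ y ⟧ᵒ ρ = ρ x - ρ y
  ⟦ x ⊗ y ⟧ᵒ ρ = ρ x * ρ y
  ⟦ x ⊘ y ⟧ᵒ ρ = ρ x * ρ y ⁻¹

  runFrom : ∀ {X L P k} → Program X L P k → (X → Carrier) → Vector Carrier k →
            Σ L (λ l → P l → Carrier)
  runFrom (return l out) ξ ρ = l , λ e → [ ξ , ρ ]′ (out e)
  runFrom (compute o t)  ξ ρ = runFrom t ξ (⟦ o ⟧ᵒ [ ξ , ρ ]′ ∷ ρ)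
  runFrom (compare x y t u) ξ ρ with [ ξ , ρ ]′ x ≤? [ ξ , ρ ]′ y
  ... | yes _ = runFrom t ξ ρ
  ... | no  _ = runFrom u ξ ρ

  run : ∀ {X L P} → Program X L P 0 → (X → Carrier) → Σ L (λ l → P l → Carrier)
  run t ξ = runFrom t ξ []

-- For every MDP of shape S, compute another MDP.
Transformation : Set
Transformation = (S : Shape) → Program (Entry S) Shape Entry 0

-- For every MDP of shape S and every policy of an MDP of shape T, compute a
-- policy of the former; no numbers are returned.
Recovery : Set
Recovery = (S T : Shape) → Policy T → Program (Entry S) (Policy S) (λ _ → ⊥) 0

-- Polynomials with natural coefficients in two variables; the solver's
-- negation is the identity on ℕ.
SizePolynomial : Set
SizePolynomial = +-*-Solver.Polynomial 2

_at_ : SizePolynomial → Shape → ℕ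
P at S = +-*-Solver.⟦ P ⟧ (states S Vec.∷ totalActions S Vec.∷ Vec.[])

module _ {c ℓ₁ ℓ₂} (F : OrderedField c ℓ₁ ℓ₂) where
  open OrderedField F
  open MDP F
  open Semantics F

  -- The transformation has to write its output down, so the size of the output
  -- counts as well; operations alone does not see it, because a leaf may
  -- mention the same operand any number of times.
  record BinaryReduction (transform : Transformation) (recover : Recovery)
                         (sizeBound : SizePolynomial)
                         (S : Shape) (d : Entry S → Carrier) :
                         Set (c ⊔ˡ ℓ₁ ⊔ˡ ℓ₂) where
    T : Shape
    T = proj₁ (run (transform S) d)

    e : Entry T → Carrier
    e = proj₂ (run (transform S) d)

    field
      isDiscountedMDP : IsDiscountedMDP T e
      isBinary        : IsBinary T
      outputSize      : states T ℕ.+ totalActions T ℕ.≤ sizeBound at S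
      recovers        : ∀ σ → IsOptimal T e σ →
                        IsOptimal S d (proj₁ (run (recover S T σ) d))

-- Replace the choice among the actions of a state j by a chain of binary
-- choices: take the current action, or pass to the next place of the chain.
-- Every place of the chain costs one more discount step.  This is compensated
-- by a slower discount g = 1 - ε, where ε = (1 - γ) / D and D exceeds the length
-- of a chain: with w = 1 / g, the action at place l gets the reward w ^ l * r and
-- returns to the chains' entries with probability γ * w ^ (l + 1) * p, the rest
-- of the probability going to a sink of value 0.  Bernoulli's inequality
-- γ = 1 - D ε ≤ g ^ D makes this a probability.  The values at the entries of
-- the chains then solve the original Bellman equations, and an optimal policy of
-- the original process takes the first action at which the binary one stops.

module Submission where

open import Defs

import Algebra.Properties.CommutativeSemigroup as CommutativeSemigroup
import Algebra.Properties.Group as GroupProperties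
import Algebra.Properties.Monoid.Mult as MonoidMult
import Algebra.Properties.Monoid.Sum as MonoidSum
import Algebra.Properties.Ring as RingProperties
import Algebra.Properties.Semiring.Exp as SemiringExp
import Algebra.Properties.Semiring.Mult as SemiringMult
import Algebra.Properties.Semiring.Sum as SemiringSum
open import Data.Bool using (true; false; if_then_else_)
open import Data.Empty using (⊥-elim)
open import Data.Fin as Fin
  using (Fin; zero; suc; toℕ; fromℕ<; inject≤; combine; remQuot; splitAt; _↑ˡ_; _↑ʳ_)
import Data.Fin.Properties as Fin
open import Data.Nat as ℕ using (ℕ; zero; suc; z≤n; s≤s)
import Data.Nat.Properties as ℕ
open import Data.Nat.Solver using (module +-*-Solver)
open import Data.Product using (Σ; Σ-syntax; ∃; ∃-syntax; _×_; _,_; proj₁; proj₂; uncurry)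
open import Data.Sum using (_⊎_; inj₁; inj₂; [_,_]′; map₂)
open import Data.Vec.Functional using (Vector; _∷_; [])
open import Function using (_∘_; id)
open import Level using (Level)
open import Relation.Binary using (Poset; IsDecTotalOrder)
open import Relation.Binary.PropositionalEquality as ≡ using (_≡_)
import Relation.Binary.Reasoning.PartialOrder as PartialOrderReasoning
import Relation.Binary.Reasoning.Setoid as SetoidReasoning
open import Relation.Nullary using (¬_; yes; no; does)

-- Arithmetic expressions and their compilation

data BinaryOperator : Set where
  add subtract multiply divide : BinaryOperator

node : ∀ {V} → BinaryOperator → V → V → Operation V
node add      = _⊕_
node subtract = _⊖_
node multiply = _⊗_
node divide   = _⊘_

-- Subterms are not shared: each entry of the binary process recomputes `ε`, `g` and `w` from the
-- input. The cost stays polynomial because numerals and exponents are at most linear in the total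
-- number of actions.
data Expr (X : Set) : Set where
  var      : X → Expr X
  `0 `1    : Expr X
  binary   : BinaryOperator → Expr X → Expr X → Expr X

infixl 6 _`+_ _`-_
infixl 7 _`*_ _`/_
infixr 8 _`^_

pattern _`+_ a b = binary add a b
pattern _`-_ a b = binary subtract a b
pattern _`*_ a b = binary multiply a b
pattern _`/_ a b = binary divide a b

numeral : ∀ {X} → ℕ → Expr X
numeral zero    = `0
numeral (suc k) = `1 `+ numeral k

_`^_ : ∀ {X} → Expr X → ℕ → Expr X
a `^ zero  = `1
a `^ suc k = a `* a `^ k

cost : ∀ {X} → Expr X → ℕ
cost (var x)        = 0
cost `0             = 1
cost `1             = 1
cost (binary o a b) = suc (cost a ℕ.+ cost b)

cost-numeral : ∀ {X} k → cost {X} (numeral k) ≡ suc (k ℕ.* 2)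
cost-numeral zero    = ≡.refl
cost-numeral (suc k) = ≡.cong (2 ℕ.+_) (cost-numeral k)

cost-^ : ∀ {X} (a : Expr X) k → cost (a `^ k) ≡ suc (k ℕ.* suc (cost a))
cost-^ a zero    = ≡.refl
cost-^ a (suc k) = ≡.cong suc (≡.trans (≡.cong (cost a ℕ.+_) (cost-^ a k)) (ℕ.+-suc (cost a) _))

-- A continuation receives the number of results computed so far, the new
-- places of the old results, and the operands it has been waiting for.
module _ {X L : Set} {P : L → Set} where

  build : ∀ {k} → Expr X →
          (∀ {k′} → (Fin k → Fin k′) → X ⊎ Fin k′ → Program X L P k′) → Program X L P k
  build (var x)        c = c id (inj₁ x)
  build `0             c = compute zero′ (c suc (inj₂ zero))
  build `1             c = compute one′ (c suc (inj₂ zero))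
  build (binary o a b) c =
    -- The code for `b` appends results after `x` was computed, so `x` has to be moved along `r₂`.
    build a λ r₁ x → build b λ r₂ y →
    compute (node o (map₂ r₂ x) y) (c (suc ∘ r₂ ∘ r₁) (inj₂ zero))

  buildAll : ∀ {k m} → (Fin m → Expr X) →
             (∀ {k′} → (Fin k → Fin k′) → (Fin m → X ⊎ Fin k′) → Program X L P k′) →
             Program X L P k
  buildAll {m = zero}  a c = c id λ ()
  buildAll {m = suc m} a c =
    build (a zero) λ r₁ x → buildAll (a ∘ suc) λ r₂ xs →
    c (r₂ ∘ r₁) (map₂ r₂ x ∷ xs)

  -- The number of results in front of the continuation is fixed only by `build`, so the bound `n`
  -- is required uniformly in `k′`.
  operations-build : ∀ {k} a (c : ∀ {k′} → (Fin k → Fin k′) → X ⊎ Fin k′ → Program X L P k′) {n} →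
                     (∀ {k′} (r : Fin k → Fin k′) x → operations (c r x) ℕ.≤ n) →
                     operations (build a c) ℕ.≤ cost a ℕ.+ n
  operations-build (var x)        c c≤n = c≤n id (inj₁ x)
  operations-build `0             c c≤n = s≤s (c≤n suc (inj₂ zero))
  operations-build `1             c c≤n = s≤s (c≤n suc (inj₂ zero))
  operations-build (binary o a b) c {n} c≤n = ℕ.≤-trans
    (operations-build a _ λ r₁ x → operations-build b _ λ r₂ y →
      s≤s (c≤n (suc ∘ r₂ ∘ r₁) (inj₂ zero)))
    (ℕ.≤-reflexive rearranged)
    where
    rearranged : cost a ℕ.+ (cost b ℕ.+ suc n) ≡ suc (cost a ℕ.+ cost b ℕ.+ n)
    rearranged = ≡.trans (≡.sym (ℕ.+-assoc (cost a) (cost b) (suc n))) (ℕ.+-suc _ n)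

  operations-buildAll : ∀ {k m} (a : Fin m → Expr X)
                        (c : ∀ {k′} → (Fin k → Fin k′) → (Fin m → X ⊎ Fin k′) → Program X L P k′) {b n} →
                        (∀ i → cost (a i) ℕ.≤ b) →
                        (∀ {k′} (r : Fin k → Fin k′) xs → operations (c r xs) ℕ.≤ n) →
                        operations (buildAll a c) ℕ.≤ m ℕ.* b ℕ.+ n
  operations-buildAll {m = zero}  a c a≤b c≤n = c≤n id λ ()
  operations-buildAll {m = suc m} a c {b} {n} a≤b c≤n = ℕ.≤-trans
    (operations-build (a zero) _ λ r₁ x → operations-buildAll (a ∘ suc) _ (a≤b ∘ suc) λ r₂ xs →
      c≤n (r₂ ∘ r₁) (map₂ r₂ x ∷ xs))
    (ℕ.≤-trans (ℕ.+-monoˡ-≤ (m ℕ.* b ℕ.+ n) (a≤b zero)) (ℕ.≤-reflexive (≡.sym (ℕ.+-assoc b _ n))))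

  tabulate : ∀ {m} → (Fin m → Expr X) → (l : L) → (P l → Fin m) → Program X L P 0
  tabulate a l place = buildAll a λ _ xs → return l (xs ∘ place)

  operations-tabulate : ∀ {m} (a : Fin m → Expr X) l place {b} → (∀ i → cost (a i) ℕ.≤ b) →
                        operations (tabulate a l place) ℕ.≤ m ℕ.* b
  operations-tabulate {m} a l place {b} a≤b =
    ℕ.≤-trans (operations-buildAll a _ a≤b λ _ _ → z≤n) (ℕ.≤-reflexive (ℕ.+-identityʳ (m ℕ.* b)))

-- Soundness of the compilation.

module _ {c ℓ₁ ℓ₂} (F : OrderedField c ℓ₁ ℓ₂) where
  open OrderedField F hiding (zero)
  open Semantics F

  operator : BinaryOperator → Carrier → Carrier → Carrier
  operator add      x y = x + y
  operator subtract x y = x - y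
  operator multiply x y = x * y
  operator divide   x y = x * y ⁻¹

  ⟦node⟧ : ∀ {V} o (x y : V) ρ → ⟦ node o x y ⟧ᵒ ρ ≡ operator o (ρ x) (ρ y)
  ⟦node⟧ add      x y ρ = ≡.refl
  ⟦node⟧ subtract x y ρ = ≡.refl
  ⟦node⟧ multiply x y ρ = ≡.refl
  ⟦node⟧ divide   x y ρ = ≡.refl

  ⟦_⟧ : ∀ {X} → Expr X → (X → Carrier) → Carrier
  ⟦ var x ⟧        ξ = ξ x
  ⟦ `0 ⟧           ξ = 0#
  ⟦ `1 ⟧           ξ = 1#
  ⟦ binary o a b ⟧ ξ = operator o (⟦ a ⟧ ξ) (⟦ b ⟧ ξ)

  module _ {X L : Set} {P : L → Set} (ξ : X → Carrier) where

    record Extends {k k′} (ρ : Vector Carrier k) (r : Fin k → Fin k′) (ρ′ : Vector Carrier k′) :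
                   Set c where
      constructor extends
      field kept : ∀ i → ρ′ (r i) ≡ ρ i

    open Extends

    [_]-map₂ : ∀ {k k′} {ρ : Vector Carrier k} {r : Fin k → Fin k′} {ρ′} → Extends ρ r ρ′ →
               ∀ x → [ ξ , ρ′ ]′ (map₂ r x) ≡ [ ξ , ρ ]′ x
    [ _ ]-map₂ (inj₁ x) = ≡.refl
    [ h ]-map₂ (inj₂ i) = kept h i

    -- The compiled code contains no comparison before its continuation, so every run follows one
    -- path and reaches the continuation in an environment extending `ρ`. The code performs
    -- literally the operations of `⟦ a ⟧`, whence `≡` instead of `≈`.
    runFrom-build : ∀ {k} a (c : ∀ {k′} → (Fin k → Fin k′) → X ⊎ Fin k′ → Program X L P k′) ρ →
      ∃ λ k′ → Σ[ r ∈ (Fin k → Fin k′) ] ∃ λ x → ∃ λ ρ′ →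
        runFrom (build a c) ξ ρ ≡ runFrom (c r x) ξ ρ′ ×
        Extends ρ r ρ′ × [ ξ , ρ′ ]′ x ≡ ⟦ a ⟧ ξ
    runFrom-build (var x) c ρ = _ , id , inj₁ x , ρ , ≡.refl , extends (λ _ → ≡.refl) , ≡.refl
    runFrom-build `0 c ρ = _ , suc , inj₂ zero , _ , ≡.refl , extends (λ _ → ≡.refl) , ≡.refl
    runFrom-build `1 c ρ = _ , suc , inj₂ zero , _ , ≡.refl , extends (λ _ → ≡.refl) , ≡.refl
    runFrom-build (binary o a b) c ρ
      with k₁ , r₁ , x , ρ₁ , run₁ , ext₁ , x≡ ← runFrom-build a
             (λ r₁ x → build b λ r₂ y → compute (node o (map₂ r₂ x) y) (c (suc ∘ r₂ ∘ r₁) (inj₂ zero))) ρ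
      with k₂ , r₂ , y , ρ₂ , run₂ , ext₂ , y≡ ← runFrom-build b
             (λ r₂ y → compute (node o (map₂ r₂ x) y) (c (suc ∘ r₂ ∘ r₁) (inj₂ zero))) ρ₁
      = _ , (suc ∘ r₂ ∘ r₁) , inj₂ zero , _ , ≡.trans run₁ run₂ ,
        extends (λ i → ≡.trans (kept ext₂ (r₁ i)) (kept ext₁ i)) ,
        ≡.trans (⟦node⟧ o _ _ _) (≡.cong₂ (operator o) (≡.trans ([ ext₂ ]-map₂ x) x≡) y≡)

    runFrom-buildAll : ∀ {k m} (a : Fin m → Expr X)
      (c : ∀ {k′} → (Fin k → Fin k′) → (Fin m → X ⊎ Fin k′) → Program X L P k′) ρ →
      ∃ λ k′ → Σ[ r ∈ (Fin k → Fin k′) ] ∃ λ xs → ∃ λ ρ′ →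
        runFrom (buildAll a c) ξ ρ ≡ runFrom (c r xs) ξ ρ′ ×
        Extends ρ r ρ′ × (∀ i → [ ξ , ρ′ ]′ (xs i) ≡ ⟦ a i ⟧ ξ)
    runFrom-buildAll {m = zero} a c ρ =
      _ , id , _ , ρ , ≡.refl , extends (λ _ → ≡.refl) , λ ()
    runFrom-buildAll {m = suc m} a c ρ
      with k₁ , r₁ , x , ρ₁ , run₁ , ext₁ , x≡ ← runFrom-build (a zero)
             (λ r₁ x → buildAll (a ∘ suc) λ r₂ xs → c (r₂ ∘ r₁) (map₂ r₂ x ∷ xs)) ρ
      with k₂ , r₂ , xs , ρ₂ , run₂ , ext₂ , xs≡ ← runFrom-buildAll (a ∘ suc)
             (λ r₂ xs → c (r₂ ∘ r₁) (map₂ r₂ x ∷ xs)) ρ₁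
      = _ , (r₂ ∘ r₁) , (map₂ r₂ x ∷ xs) , _ , ≡.trans run₁ run₂ ,
        extends (λ i → ≡.trans (kept ext₂ (r₁ i)) (kept ext₁ i)) ,
        λ { zero → ≡.trans ([ ext₂ ]-map₂ x) x≡ ; (suc i) → xs≡ i }

    run-tabulate : ∀ {m} (a : Fin m → Expr X) l (place : P l → Fin m) →
                   ∃ λ out → run (tabulate a l place) ξ ≡ (l , out) × (∀ x → out x ≡ ⟦ a (place x) ⟧ ξ)
    run-tabulate a l place
      with _ , _ , xs , ρ , run≡ , _ , xs≡ ← runFrom-buildAll a (λ _ xs → return l (xs ∘ place)) []
      = (λ x → [ ξ , ρ ]′ (xs (place x))) , run≡ , (xs≡ ∘ place)

-- Chains of binary choices

pick : ∀ {a} {A : Set a} → Fin 2 → A → A → A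
pick zero    x y = x
pick (suc _) x y = y

-- The value of g at the place after l, or s if l is the last place.
onward : ∀ {a} {A : Set a} {m} → A → (Fin (suc m) → A) → Fin (suc m) → A
onward {m = zero}  s g zero    = s
onward {m = suc m} s g zero    = g (suc zero)
onward {m = suc m} s g (suc l) = onward s (g ∘ suc) l

onward-natural : ∀ {a b} {A : Set a} {B : Set b} (f : A → B) {m} s g (l : Fin (suc m)) →
                 f (onward s g l) ≡ onward (f s) (f ∘ g) l
onward-natural f {zero}  s g zero    = ≡.refl
onward-natural f {suc m} s g zero    = ≡.refl
onward-natural f {suc m} s g (suc l) = onward-natural f s (g ∘ suc) l

-- Decision `zero` stops, the other one passes on. The last place stops under either decision, so a
-- first stopping place always exists.
stopAt : ∀ {m} → (Fin (suc m) → Fin 2) → Fin (suc m)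
stopAt {zero}  σ = zero
stopAt {suc m} σ = pick (σ zero) zero (suc (stopAt (σ ∘ suc)))

-- Ordered fields, the slower discount and the values along a chain.

module OrderedFieldProperties {c ℓ₁ ℓ₂} (F : OrderedField c ℓ₁ ℓ₂) where
  open OrderedField F hiding (zero)
  open IsDecTotalOrder isDecTotalOrder public
    using (antisym; total; ≤-respˡ-≈; ≤-respʳ-≈)
    renaming (refl to ≤-refl; trans to ≤-trans; reflexive to ≤-reflexive)
  open RingProperties ring public using (-‿distribˡ-*)
  open GroupProperties +-group public using (//-rightDividesˡ; identityʳ-unique; ⁻¹-involutive)
  open SemiringMult semiring public using (×-assoc-*) renaming (_×_ to _·_)
  open SemiringExp semiring public using (_^_)

  poset : Poset c ℓ₁ ℓ₂
  poset = record { isPartialOrder = IsDecTotalOrder.isPartialOrder isDecTotalOrder }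

  module ≤-Reasoning = PartialOrderReasoning poset

  +-monoʳ-≤ : ∀ z {x y} → x ≤ y → z + x ≤ z + y
  +-monoʳ-≤ z {x} {y} x≤y = begin
    z + x ≈⟨ +-comm z x ⟩
    x + z ≤⟨ +-monoˡ-≤ z x≤y ⟩
    y + z ≈⟨ +-comm y z ⟩
    z + y ∎
    where open ≤-Reasoning

  +-cancelʳ-≤ : ∀ z {x y} → x + z ≤ y + z → x ≤ y
  +-cancelʳ-≤ z {x} {y} x+z≤y+z = begin
    x           ≈⟨ x+z-z≈x x ⟨
    x + z + - z ≤⟨ +-monoˡ-≤ (- z) x+z≤y+z ⟩
    y + z + - z ≈⟨ x+z-z≈x y ⟩
    y           ∎
    where
    open ≤-Reasoning
    x+z-z≈x : ∀ x → x + z + - z ≈ x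
    x+z-z≈x = GroupProperties.//-rightDividesʳ +-group z

  x-y+y≈x : ∀ x y → x - y + y ≈ x
  x-y+y≈x x y = //-rightDividesˡ y x

  x≤y⇒0≤y-x : ∀ {x y} → x ≤ y → 0# ≤ y - x
  x≤y⇒0≤y-x {x} {y} x≤y = ≤-respˡ-≈ (-‿inverseʳ x) (+-monoˡ-≤ (- x) x≤y)

  y≤x+y : ∀ {x} y → 0# ≤ x → y ≤ x + y
  y≤x+y y 0≤x = ≤-respˡ-≈ (+-identityˡ y) (+-monoˡ-≤ y 0≤x)

  +-nonneg : ∀ {x y} → 0# ≤ x → 0# ≤ y → 0# ≤ x + y
  +-nonneg {x} {y} 0≤x 0≤y = ≤-trans 0≤y (y≤x+y y 0≤x)

  *-monoʳ-≤ : ∀ {z x y} → 0# ≤ z → x ≤ y → x * z ≤ y * z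
  *-monoʳ-≤ {z} {x} {y} 0≤z x≤y = begin
    x * z               ≤⟨ y≤x+y _ (*-nonneg (x≤y⇒0≤y-x x≤y) 0≤z) ⟩
    (y - x) * z + x * z ≈⟨ distribʳ z (y - x) x ⟨
    (y - x + x) * z     ≈⟨ *-congʳ (x-y+y≈x y x) ⟩
    y * z               ∎
    where open ≤-Reasoning

  *-monoˡ-≤ : ∀ {z x y} → 0# ≤ z → x ≤ y → z * x ≤ z * y
  *-monoˡ-≤ {z} {x} {y} 0≤z x≤y = begin
    z * x ≈⟨ *-comm z x ⟩
    x * z ≤⟨ *-monoʳ-≤ 0≤z x≤y ⟩
    y * z ≈⟨ *-comm y z ⟩
    z * y ∎
    where open ≤-Reasoning

  0≤1 : 0# ≤ 1#
  0≤1 with total 0# 1#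
  ... | inj₁ 0≤1 = 0≤1
  ... | inj₂ 1≤0 = ≤-respʳ-≈ -1*-1≈1 (*-nonneg 0≤-1 0≤-1)
    where
    0≤-1 : 0# ≤ - 1#
    0≤-1 = ≤-respʳ-≈ (+-identityˡ _) (x≤y⇒0≤y-x 1≤0)
    -1*-1≈1 : - 1# * - 1# ≈ 1#
    -1*-1≈1 = trans (sym (-‿distribˡ-* 1# (- 1#))) (trans (-‿cong (*-identityˡ _)) (⁻¹-involutive 1#))

  ·-nonneg : ∀ k {x} → 0# ≤ x → 0# ≤ k · x
  ·-nonneg zero    0≤x = ≤-refl
  ·-nonneg (suc k) 0≤x = +-nonneg 0≤x (·-nonneg k 0≤x)

  ·-nonpos : ∀ k {x} → x ≤ 0# → k · x ≤ 0#
  ·-nonpos zero    x≤0 = ≤-refl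
  ·-nonpos (suc k) {x} x≤0 = begin
    x + k · x  ≤⟨ +-monoˡ-≤ _ x≤0 ⟩
    0# + k · x ≈⟨ +-identityˡ _ ⟩
    k · x      ≤⟨ ·-nonpos k x≤0 ⟩
    0#         ∎
    where open ≤-Reasoning

  ^-nonneg : ∀ k {x} → 0# ≤ x → 0# ≤ x ^ k
  ^-nonneg zero    0≤x = 0≤1
  ^-nonneg (suc k) 0≤x = *-nonneg 0≤x (^-nonneg k 0≤x)

  -- D = 2 + N is one more than chains of length 1 + N need, so that g is positive
  -- even if N and γ are zero.
  module SlowDiscount {γ ε} N (0≤γ : 0# ≤ γ) (γ<1 : γ < 1#) (γ+Dε≈1 : γ + (2 ℕ.+ N) · ε ≈ 1#) where

    g w : Carrier
    g = 1# - ε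
    -- The factor `1#` makes this literally the value of the expression `w-expr`.
    w = 1# * g ⁻¹

    private
      1≰γ : ¬ 1# ≤ γ
      1≰γ 1≤γ = proj₂ γ<1 (antisym (proj₁ γ<1) 1≤γ)

      ε≰0 : ¬ ε ≤ 0#
      ε≰0 ε≤0 = 1≰γ (begin
        1#                 ≈⟨ γ+Dε≈1 ⟨
        γ + (2 ℕ.+ N) · ε  ≤⟨ +-monoʳ-≤ γ (·-nonpos (2 ℕ.+ N) ε≤0) ⟩
        γ + 0#             ≈⟨ +-identityʳ γ ⟩
        γ                  ∎)
        where open ≤-Reasoning

      0≤ε : 0# ≤ ε
      0≤ε with total 0# ε
      ... | inj₁ 0≤ε = 0≤ε
      ... | inj₂ ε≤0 = ⊥-elim (ε≰0 ε≤0)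

    g+ε≈1 : g + ε ≈ 1#
    g+ε≈1 = x-y+y≈x 1# ε

    -- Two of the `2 + N` copies of `ε` already give `ε + ε ≤ 1#`, and `1#` is `g + ε`. As `ε` is
    -- positive, `g` is then positive and invertible.
    ε≤g : ε ≤ g
    ε≤g = +-cancelʳ-≤ ε (begin
      ε + ε                    ≤⟨ +-monoʳ-≤ ε (≤-respʳ-≈ (+-comm _ ε) (y≤x+y ε (·-nonneg N 0≤ε))) ⟩
      ε + (ε + N · ε)          ≤⟨ y≤x+y _ 0≤γ ⟩
      γ + (2 ℕ.+ N) · ε        ≈⟨ γ+Dε≈1 ⟩
      1#                       ≈⟨ g+ε≈1 ⟨
      g + ε                    ∎)
      where open ≤-Reasoning

    0≤g : 0# ≤ g
    0≤g = ≤-trans 0≤ε ε≤g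

    g<1 : g < 1#
    g<1 = ≤-respʳ-≈ (trans (+-comm ε g) g+ε≈1) (y≤x+y g 0≤ε) , λ g≈1 → ε≰0 (+-cancelʳ-≤ g (begin
      ε + g  ≈⟨ +-comm ε g ⟩
      g + ε  ≈⟨ g+ε≈1 ⟩
      1#     ≈⟨ g≈1 ⟨
      g      ≈⟨ +-identityˡ g ⟨
      0# + g ∎))
      where open ≤-Reasoning

    g*w≈1 : g * w ≈ 1#
    g*w≈1 = trans (*-congˡ (*-identityˡ _)) (⁻¹-inverseʳ g λ g≈0 → ε≰0 (≤-respʳ-≈ g≈0 ε≤g))

    0≤w : 0# ≤ w
    0≤w with total 0# w
    ... | inj₁ 0≤w = 0≤w
    ... | inj₂ w≤0 = ⊥-elim (0≉1 (antisym 0≤1 (begin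
      1#     ≈⟨ g*w≈1 ⟨
      g * w  ≤⟨ *-monoˡ-≤ 0≤g w≤0 ⟩
      g * 0# ≈⟨ zeroʳ g ⟩
      0#     ∎)))
      where open ≤-Reasoning

    -- This forces the value of the sink: `z * ε` is `z - g * z`, hence zero, and `ε` is invertible.
    fixedPoint≈0 : ∀ {z} → z ≈ g * z → z ≈ 0#
    fixedPoint≈0 {z} z≈gz = begin
      z                  ≈⟨ *-identityʳ z ⟨
      z * 1#             ≈⟨ *-congˡ (⁻¹-inverseʳ ε λ ε≈0 → ε≰0 (≤-reflexive ε≈0)) ⟨
      z * (ε * ε ⁻¹)     ≈⟨ *-assoc z ε _ ⟨
      z * ε * ε ⁻¹       ≈⟨ *-congʳ zε≈0 ⟩
      0# * ε ⁻¹          ≈⟨ zeroˡ _ ⟩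
      0#                 ∎
      where
      open SetoidReasoning setoid
      zε≈0 : z * ε ≈ 0#
      zε≈0 = identityʳ-unique z (z * ε) (begin
        z + z * ε        ≈⟨ +-congʳ (trans z≈gz (*-comm g z)) ⟩
        z * g + z * ε    ≈⟨ distribˡ z g ε ⟨
        z * (g + ε)      ≈⟨ *-congˡ g+ε≈1 ⟩
        z * 1#           ≈⟨ *-identityʳ z ⟩
        z                ∎)

    private
      -- The product `(x + ε) * g` falls short of `x + ε` by `(x + ε) * ε`, which is at most `ε`; so
      -- it is at least `x`, and multiplying by `w` cancels `g`. Thus one factor `w` is paid for by
      -- one summand `ε`, and `bernoulli` repeats this trade `m` times.
      step : ∀ {x} → x + ε ≤ 1# → x * w ≤ x + ε
      step {x} x+ε≤1 = begin
        x * w              ≤⟨ *-monoʳ-≤ 0≤w x≤[x+ε]g ⟩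
        (x + ε) * g * w    ≈⟨ *-assoc _ g w ⟩
        (x + ε) * (g * w)  ≈⟨ *-congˡ g*w≈1 ⟩
        (x + ε) * 1#       ≈⟨ *-identityʳ _ ⟩
        x + ε              ∎
        where
        open ≤-Reasoning
        x≤[x+ε]g : x ≤ (x + ε) * g
        x≤[x+ε]g = +-cancelʳ-≤ ε (begin
          x + ε                       ≈⟨ *-identityʳ _ ⟨
          (x + ε) * 1#                ≈⟨ *-congˡ g+ε≈1 ⟨
          (x + ε) * (g + ε)           ≈⟨ distribˡ (x + ε) g ε ⟩
          (x + ε) * g + (x + ε) * ε   ≤⟨ +-monoʳ-≤ _ (*-monoʳ-≤ 0≤ε x+ε≤1) ⟩
          (x + ε) * g + 1# * ε        ≈⟨ +-congˡ (*-identityˡ ε) ⟩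
          (x + ε) * g + ε             ∎)

    -- Here γ + k ε = 1 - m ε.
    bernoulli : ∀ k m → k ℕ.+ m ≡ 2 ℕ.+ N → (γ + k · ε) * w ^ m ≤ 1#
    bernoulli k zero k+m≡D = ≤-reflexive (trans (*-identityʳ _)
      (trans (+-congˡ (≡→≈ (≡.cong (_· ε) (≡.trans (≡.sym (ℕ.+-identityʳ k)) k+m≡D)))) γ+Dε≈1))
      where
      ≡→≈ : ∀ {x y} → x ≡ y → x ≈ y
      ≡→≈ ≡.refl = refl
    bernoulli k (suc m) k+1+m≡D = begin
      (γ + k · ε) * (w * w ^ m)  ≈⟨ *-assoc _ w _ ⟨
      (γ + k · ε) * w * w ^ m    ≤⟨ *-monoʳ-≤ (^-nonneg m 0≤w) (step (≤-respˡ-≈ x≈ ≤1)) ⟩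
      (γ + k · ε + ε) * w ^ m    ≈⟨ *-congʳ x≈ ⟨
      (γ + suc k · ε) * w ^ m    ≤⟨ bernoulli (suc k) m (≡.trans (≡.sym (ℕ.+-suc k m)) k+1+m≡D) ⟩
      1#                         ∎
      where
      open ≤-Reasoning
      x≈ : γ + suc k · ε ≈ γ + k · ε + ε
      x≈ = trans (+-congˡ (+-comm ε _)) (sym (+-assoc γ _ ε))
      k<D : suc k ℕ.≤ 2 ℕ.+ N
      k<D = ≡.subst (suc k ℕ.≤_) (≡.trans (≡.sym (ℕ.+-suc k m)) k+1+m≡D) (ℕ.m≤m+n (suc k) m)
      ·-monoˡ : ∀ {i j} → i ℕ.≤ j → i · ε ≤ j · ε
      ·-monoˡ {j = j} z≤n = ·-nonneg j 0≤ε
      ·-monoˡ (s≤s i≤j) = +-monoʳ-≤ ε (·-monoˡ i≤j)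
      ≤1 : γ + suc k · ε ≤ 1#
      ≤1 = ≤-respʳ-≈ γ+Dε≈1 (+-monoʳ-≤ γ (·-monoˡ k<D))

    -- Adding `D - m` copies of `ε` to `γ` only enlarges the left side and leads to `bernoulli` with
    -- `k = D - m`, where `D = 2 + N`.
    γw^m≤1 : ∀ {m} → m ℕ.≤ 2 ℕ.+ N → γ * w ^ m ≤ 1#
    γw^m≤1 {m} m≤D = ≤-trans
      (*-monoʳ-≤ (^-nonneg m 0≤w) (≤-respʳ-≈ (+-comm _ γ) (y≤x+y γ (·-nonneg (2 ℕ.+ N ℕ.∸ m) 0≤ε))))
      (bernoulli (2 ℕ.+ N ℕ.∸ m) m (ℕ.m∸n+n≡m m≤D))

    -- The discount for `k` passes undoes the scaling by `w ^ k` at place `k`.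
    g^k*w^k*x≈x : ∀ k x → g ^ k * (w ^ k * x) ≈ x
    g^k*w^k*x≈x zero x = trans (*-identityˡ _) (*-identityˡ x)
    g^k*w^k*x≈x (suc k) x = begin
      g * g ^ k * (w * w ^ k * x)     ≈⟨ *-cong (*-comm g _) (*-assoc w _ x) ⟩
      g ^ k * g * (w * (w ^ k * x))   ≈⟨ *-assoc _ g _ ⟩
      g ^ k * (g * (w * (w ^ k * x))) ≈⟨ *-congˡ (*-assoc g w _) ⟨
      g ^ k * (g * w * (w ^ k * x))   ≈⟨ *-congˡ (trans (*-congʳ g*w≈1) (*-identityˡ _)) ⟩
      g ^ k * (w ^ k * x)             ≈⟨ g^k*w^k*x≈x k x ⟩
      x                               ∎
      where open SetoidReasoning setoid

  -- The right-hand side of the Bellman equation on one chain, with `t` the values of taking and `u`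
  -- those of the places. The default `t l` is reached only at the last place, where both decisions
  -- take.
  chainValue : ∀ {m} → Carrier → (t u : Fin (suc m) → Carrier) → Fin (suc m) → Fin 2 → Carrier
  chainValue g t u l a = pick a (t l) (onward (t l) (λ l′ → g * u l′) l)

  onward-cong : ∀ {m s s′} {f f′ : Fin (suc m) → Carrier} → s ≈ s′ → (∀ l → f l ≈ f′ l) →
                ∀ l → onward s f l ≈ onward s′ f′ l
  onward-cong {zero}  s≈ f≈ zero    = s≈
  onward-cong {suc m} s≈ f≈ zero    = f≈ (suc zero)
  onward-cong {suc m} s≈ f≈ (suc l) = onward-cong s≈ (f≈ ∘ suc) l

  module _ {g} (0≤g : 0# ≤ g) where

    -- Unrolling the equations from the entry of the chain gains a factor `g` at every pass, until
    -- the first stop contributes its `t`.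
    stopAt-value : ∀ {m} {t u : Fin (suc m) → Carrier} (σ : Fin (suc m) → Fin 2) →
                   (∀ l → u l ≈ chainValue g t u l (σ l)) →
                   u zero ≈ g ^ toℕ (stopAt σ) * t (stopAt σ)
    stopAt-value {zero} {t} σ u≈ with σ zero | u≈ zero
    ... | zero  | u≈t = trans u≈t (sym (*-identityˡ _))
    ... | suc _ | u≈t = trans u≈t (sym (*-identityˡ _))
    stopAt-value {suc m} {t} {u} σ u≈ with σ zero | u≈ zero
    ... | zero  | u≈t  = trans u≈t (sym (*-identityˡ _))
    ... | suc _ | u≈gu = trans u≈gu (trans (*-congˡ (stopAt-value (σ ∘ suc) (u≈ ∘ suc))) (sym (*-assoc g _ _)))

    -- Passing up to `l` and taking there is one way through the chain; the inequalities for its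
    -- steps compose because multiplication by `g` is monotone.
    stop-≤ : ∀ {m} {t u : Fin (suc m) → Carrier} → (∀ l a → chainValue g t u l a ≤ u l) →
             ∀ l → g ^ toℕ l * t l ≤ u zero
    stop-≤ ≤u zero = ≤-respˡ-≈ (sym (*-identityˡ _)) (≤u zero zero)
    stop-≤ {suc m} {t} {u} ≤u (suc l) = begin
      g * g ^ toℕ l * t (suc l)   ≈⟨ *-assoc g _ _ ⟩
      g * (g ^ toℕ l * t (suc l)) ≤⟨ *-monoˡ-≤ 0≤g (stop-≤ (≤u ∘ suc) l) ⟩
      g * u (suc zero)            ≤⟨ ≤u zero (suc zero) ⟩
      u zero                      ∎
      where open ≤-Reasoning

-- The binary process

open +-*-Solver using (con) renaming (_:+_ to _∔_; _:*_ to _∙_; var to unknown)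

term≤sum : ∀ {n} (t : Fin n → ℕ) i → t i ℕ.≤ MonoidSum.sum ℕ.+-0-monoid t
term≤sum t zero    = ℕ.m≤m+n (t zero) _
term≤sum t (suc i) = ℕ.≤-trans (term≤sum (t ∘ suc) i) (ℕ.m≤n+m _ (t zero))

sum-const : ∀ n k → MonoidSum.sum ℕ.+-0-monoid {n} (λ _ → k) ≡ n ℕ.* k
sum-const zero    k = ≡.refl
sum-const (suc n) k = ≡.cong (k ℕ.+_) (sum-const n k)

isPositive : ℕ → Fin 2
isPositive zero    = zero
isPositive (suc _) = suc zero

isPositive-toℕ : ∀ a → isPositive (toℕ a) ≡ a
isPositive-toℕ zero       = ≡.refl
isPositive-toℕ (suc zero) = ≡.refl

-- The recovery gets a policy of a shape that it cannot compare with the target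
-- shape, so it reads the policy by number; numbers out of range give zero.
decision : (T : Shape) → Policy T → ℕ → Fin 2
decision T σ x with x ℕ.<? states T
... | yes x<n = isPositive (toℕ (σ (fromℕ< x<n)))
... | no  _   = zero

module Gadget (S : Shape) where

  -- All chains get the same length, greater than every number of actions, so that the positions are
  -- a rectangle and the sink.
  layers size : ℕ
  layers = suc (totalActions S)
  size   = suc (layers ℕ.* states S)

  target : Shape
  target = record { states = size ; actions = λ _ → 2 ; actions≥1 = λ _ → s≤s z≤n }

  data Position : Set where
    sink  : Position
    place : Fin layers → Fin (states S) → Position

  -- The numbering goes layer by layer: the entries of all chains directly follow the sink, so a sum
  -- over states splits there.
  encode : Position → Fin size
  encode sink     = zero
  encode (place l j) = suc (combine l j)

  decode : Fin size → Position
  decode zero    = sink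
  decode (suc x) = uncurry place (remQuot (states S) x)

  decode-encode : ∀ x → decode (encode x) ≡ x
  decode-encode sink     = ≡.refl
  decode-encode (place l j) = ≡.cong (uncurry place) (Fin.remQuot-combine l j)

  -- Places beyond the last action repeat action `zero`. This adds no new choice, and every action
  -- still has a place.
  clamp : ∀ j → Fin layers → Fin (actions S j)
  clamp j l with toℕ l ℕ.<? actions S j
  ... | yes l<a = fromℕ< l<a
  ... | no  _   = fromℕ< (actions≥1 S j)

  clamp-surjective : ∀ j i → ∃ λ l → clamp j l ≡ i
  clamp-surjective j i = l , clamp-l≡i
    where
    l : Fin layers
    l = inject≤ i (ℕ.m≤n⇒m≤1+n (term≤sum (actions S) j))
    l≡i : toℕ l ≡ toℕ i
    l≡i = Fin.toℕ-inject≤ i _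
    clamp-l≡i : clamp j l ≡ i
    clamp-l≡i with toℕ l ℕ.<? actions S j
    ... | yes l<a = Fin.toℕ-injective (≡.trans (Fin.toℕ-fromℕ< l<a) l≡i)
    ... | no  l≮a = ⊥-elim (l≮a (≡.subst (ℕ._< actions S j) (≡.sym l≡i) (Fin.toℕ<n i)))

  γ-expr ε-expr g-expr w-expr : Expr (Entry S)
  γ-expr = var discount
  -- The denominator `suc layers` is `D = 2 + N` for `N = totalActions S`.
  ε-expr = (`1 `- γ-expr) `/ numeral (suc layers)
  g-expr = `1 `- ε-expr
  w-expr = `1 `/ g-expr

  follow-expr : Fin layers → Expr (Entry S)
  follow-expr l = γ-expr `* w-expr `^ suc (toℕ l)

  data Move : Set where
    pass : Position → Move
    take : Fin layers → Fin (states S) → Move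

  -- Every state has exactly two actions; at the sink and at the last place of a chain both give the
  -- same move.
  move : Position → Fin 2 → Move
  move sink     a = pass sink
  move (place l j) a = pick a (take l j) (onward (take l j) (λ l′ → pass (place l′ j)) l)

  reward-expr : Move → Expr (Entry S)
  reward-expr (pass _)   = `0
  reward-expr (take l j) = w-expr `^ toℕ l `* var (reward j (clamp j l))

  take-expr : Fin layers → Fin (states S) → Position → Expr (Entry S)
  take-expr l j sink           = `1 `- follow-expr l
  take-expr l j (place zero k)    = follow-expr l `* var (probability j (clamp j l) k)
  take-expr l j (place (suc _) k) = `0

  -- The equality test concerns state numbers, so it is settled when the tree is constructed and
  -- costs no operation.
  probability-expr : Move → Fin size → Expr (Entry S)
  probability-expr (pass x)   y = if does (encode x Fin.≟ y) then `1 else `0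
  probability-expr (take l j) y = take-expr l j (decode y)

  entry-expr : Entry target → Expr (Entry S)
  entry-expr discount            = g-expr
  entry-expr (reward x a)        = reward-expr (move (decode x) a)
  entry-expr (probability x a y) = probability-expr (move (decode x) a) y

  entries : ℕ
  entries = suc (size ℕ.* 2 ℕ.+ size ℕ.* 2 ℕ.* size)

  index : Entry target → Fin entries
  index discount            = zero
  index (reward x a)        = suc (combine x a ↑ˡ size ℕ.* 2 ℕ.* size)
  index (probability x a y) = suc (size ℕ.* 2 ↑ʳ combine (combine x a) y)

  rewardAt : Fin (size ℕ.* 2) → Entry target
  rewardAt = uncurry reward ∘ remQuot 2

  probabilityAt : Fin (size ℕ.* 2 ℕ.* size) → Entry target
  probabilityAt i = uncurry (λ xa y → uncurry probability (remQuot 2 xa) y) (remQuot size i)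

  entryAt : Fin entries → Entry target
  entryAt zero    = discount
  entryAt (suc i) = [ rewardAt , probabilityAt ]′ (splitAt (size ℕ.* 2) i)

  entryAt-index : ∀ x → entryAt (index x) ≡ x
  entryAt-index discount            = ≡.refl
  entryAt-index (reward x a)        = ≡.trans
    (≡.cong [ rewardAt , probabilityAt ]′ (Fin.splitAt-↑ˡ (size ℕ.* 2) (combine x a) _))
    (≡.cong (uncurry reward) (Fin.remQuot-combine x a))
  entryAt-index (probability x a y) = ≡.trans
    (≡.cong [ rewardAt , probabilityAt ]′ (Fin.splitAt-↑ʳ (size ℕ.* 2) _ (combine (combine x a) y)))
    (≡.trans
      (≡.cong (uncurry λ xa y → uncurry probability (remQuot 2 xa) y)
        (Fin.remQuot-combine (combine x a) y))
      (≡.cong (λ xa → uncurry probability xa y) (Fin.remQuot-combine x a)))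

  -- Costs of the entries.

  cost-w maxCost : ℕ
  cost-w  = 8 ℕ.+ suc layers ℕ.* 2
  -- The dearest entry is the probability `1 - γ * w ^ (l + 1)` of the sink: a power costs one
  -- operation besides its factors, multiplying by `γ` one, and subtracting from a fresh `1` two.
  maxCost = 4 ℕ.+ suc layers ℕ.* suc cost-w

  cost-g : suc (suc (cost g-expr)) ≡ cost-w
  cost-g = ≡.cong (7 ℕ.+_) (cost-numeral (suc layers))

  ^-cheap : ∀ k → k ℕ.≤ suc layers → cost (w-expr `^ k) ℕ.≤ suc (suc layers ℕ.* suc cost-w)
  ^-cheap k k≤ = ℕ.≤-trans (ℕ.≤-reflexive (cost-^ w-expr k))
    (s≤s (≡.subst (λ z → k ℕ.* suc z ℕ.≤ suc layers ℕ.* suc cost-w) (≡.sym cost-g)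
      (ℕ.*-monoˡ-≤ (suc cost-w) k≤)))

  follow-cheap : ∀ l → cost (follow-expr l) ℕ.≤ 2 ℕ.+ suc layers ℕ.* suc cost-w
  follow-cheap l = s≤s (^-cheap (suc (toℕ l)) (ℕ.m≤n⇒m≤1+n (Fin.toℕ<n l)))

  1≤maxCost : 1 ℕ.≤ maxCost
  1≤maxCost = s≤s z≤n

  reward-cheap : ∀ m → cost (reward-expr m) ℕ.≤ maxCost
  reward-cheap (pass _)   = 1≤maxCost
  reward-cheap (take l j) = ℕ.≤-trans
    (s≤s (ℕ.≤-trans (ℕ.≤-reflexive (ℕ.+-identityʳ _))
      (^-cheap (toℕ l) (ℕ.m≤n⇒m≤1+n (ℕ.<⇒≤ (Fin.toℕ<n l))))))
    (ℕ.m≤n+m _ 2)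

  take-cheap : ∀ l j x → cost (take-expr l j x) ℕ.≤ maxCost
  take-cheap l j sink           = s≤s (s≤s (follow-cheap l))
  take-cheap l j (place zero k)    = s≤s (ℕ.≤-trans (ℕ.≤-reflexive (ℕ.+-identityʳ _))
    (ℕ.m≤n⇒m≤1+n (follow-cheap l)))
  take-cheap l j (place (suc _) k) = 1≤maxCost

  probability-cheap : ∀ m y → cost (probability-expr m y) ℕ.≤ maxCost
  probability-cheap (pass x) y with does (encode x Fin.≟ y)
  ... | true  = 1≤maxCost
  ... | false = 1≤maxCost
  probability-cheap (take l j) y = take-cheap l j (decode y)

  entry-cheap : ∀ x → cost (entry-expr x) ℕ.≤ maxCost
  entry-cheap discount            = ℕ.≤-trans (ℕ.m≤n+m (cost g-expr) 2)
    (ℕ.≤-trans (ℕ.≤-reflexive cost-g) (ℕ.≤-trans (ℕ.n≤1+n cost-w)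
      (ℕ.≤-trans (ℕ.m≤m+n (suc cost-w) _) (ℕ.m≤n+m _ 4))))
  entry-cheap (reward x a)        = reward-cheap (move (decode x) a)
  entry-cheap (probability x a y) = probability-cheap (move (decode x) a) y

module _ where
  open Gadget

  transform : Transformation
  transform S = tabulate (entry-expr S ∘ entryAt S) (target S) (index S)

  -- A bare leaf: the first stopping places depend on the policy alone, so no arithmetic on the
  -- input is performed.
  recover : Recovery
  recover S T σ =
    return (λ j → clamp S j (stopAt λ l → decision T σ (toℕ (encode S (place l j))))) λ ()

  transform-cheap : ∀ S → operations (transform S) ℕ.≤ entries S ℕ.* maxCost S
  transform-cheap S = operations-tabulate (entry-expr S ∘ entryAt S) (target S) (index S)
    λ i → entry-cheap S (entryAt S i)

-- Polynomial bounds.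

states-poly layers-poly size-poly : SizePolynomial
states-poly = unknown zero
layers-poly = con 1 ∔ unknown (suc zero)
size-poly   = con 1 ∔ layers-poly ∙ states-poly

-- Mirrors `entries` and `maxCost` term by term, so that its value at `S` is their product by
-- computation; the constant 9 is the 8 of `cost-w` and the successor around it.
operations-poly : SizePolynomial
operations-poly = entries-poly ∙ maxCost-poly
  where
  entries-poly = con 1 ∔ (size-poly ∙ con 2 ∔ size-poly ∙ con 2 ∙ size-poly)
  steps-poly   = con 1 ∔ layers-poly
  maxCost-poly = con 4 ∔ steps-poly ∙ (con 9 ∔ steps-poly ∙ con 2)

output-poly : SizePolynomial
output-poly = size-poly ∔ size-poly ∙ con 2

decision-target : ∀ S (σ : Policy (Gadget.target S)) x → decision (Gadget.target S) σ (toℕ x) ≡ σ x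
decision-target S σ x with toℕ x ℕ.<? states (Gadget.target S)
... | yes x<n = ≡.trans (isPositive-toℕ _) (≡.cong σ (Fin.fromℕ<-toℕ x x<n))
... | no  x≮n = ⊥-elim (x≮n (Fin.toℕ<n x))

output-size : ∀ S → let T = Gadget.target S in states T ℕ.+ totalActions T ≡ output-poly at S
output-size S = ≡.cong (states (Gadget.target S) ℕ.+_) (sum-const (states (Gadget.target S)) 2)

-- Correctness

module _ {c ℓ₁ ℓ₂} (F : OrderedField c ℓ₁ ℓ₂) where
  open OrderedField F hiding (zero)
  open OrderedFieldProperties F
  open MDP F
  open MonoidSum +-monoid using (sum-cong-≋; sum-replicate-zero)
  open SemiringSum semiring using (*-distribˡ-sum)
  open CommutativeSemigroup *-commutativeSemigroup using (x∙yz≈y∙xz)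

  sum-++ : ∀ m {n} (f : Fin (m ℕ.+ n) → Carrier) →
           sum f ≈ sum (λ i → f (i ↑ˡ n)) + sum (λ i → f (m ↑ʳ i))
  sum-++ zero    f = sym (+-identityˡ _)
  sum-++ (suc m) f = trans (+-congˡ (sum-++ m (f ∘ suc))) (sym (+-assoc _ _ _))

  sum-0* : ∀ {n} (f : Fin n → Carrier) → sum (λ i → 0# * f i) ≈ 0#
  sum-0* {n} f = trans (sum-cong-≋ (λ i → zeroˡ (f i))) (sum-replicate-zero n)

  -- The weights have the form of the transition probabilities of a pass.
  sum-point : ∀ {X} (ξ : X → Carrier) {n} (i : Fin n) (f : Fin n → Carrier) →
              sum (λ k → ⟦_⟧ F (if does (i Fin.≟ k) then `1 else `0) ξ * f k) ≈ f i
  sum-point ξ zero    f = trans (+-cong (*-identityˡ _) (sum-0* (f ∘ suc))) (+-identityʳ _)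
  sum-point ξ (suc i) f = trans (+-cong (zeroˡ _) (sum-point ξ i (f ∘ suc))) (+-identityˡ _)

  sum-nonneg : ∀ {n} {f : Fin n → Carrier} → (∀ i → 0# ≤ f i) → 0# ≤ sum f
  sum-nonneg {zero}  0≤f = ≤-refl
  sum-nonneg {suc n} 0≤f = +-nonneg (0≤f zero) (sum-nonneg (0≤f ∘ suc))

  nonneg-term≤sum : ∀ {n} {f : Fin n → Carrier} → (∀ i → 0# ≤ f i) → ∀ i → f i ≤ sum f
  nonneg-term≤sum {f = f} 0≤f zero = ≤-respʳ-≈ (+-comm _ _) (y≤x+y (f zero) (sum-nonneg (0≤f ∘ suc)))
  nonneg-term≤sum 0≤f (suc i) = ≤-trans (nonneg-term≤sum (0≤f ∘ suc) i) (y≤x+y _ (0≤f zero))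


  ⟦^⟧ : ∀ {X} (a : Expr X) k ξ → ⟦_⟧ F (a `^ k) ξ ≡ ⟦_⟧ F a ξ ^ k
  ⟦^⟧ a zero    ξ = ≡.refl
  ⟦^⟧ a (suc k) ξ = ≡.cong (⟦_⟧ F a ξ *_) (⟦^⟧ a k ξ)

  ⟦numeral⟧ : ∀ {X} k (ξ : X → Carrier) → ⟦_⟧ F (numeral k) ξ ≡ k · 1#
  ⟦numeral⟧ zero    ξ = ≡.refl
  ⟦numeral⟧ (suc k) ξ = ≡.cong (1# +_) (⟦numeral⟧ k ξ)

  -- The data `e` is arbitrary up to `e≡`, so the argument about the process never unfolds a run of
  -- the program.
  module Correctness (S : Shape) (d : Entry S → Carrier) (isMDP : IsDiscountedMDP S d)
                     (e : Entry (Gadget.target S) → Carrier)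
                     (e≡ : ∀ x → e x ≡ ⟦_⟧ F (Gadget.entry-expr S x) d) where
    open Gadget S
    open IsDiscountedMDP isMDP

    eval : Expr (Entry S) → Carrier
    eval a = ⟦_⟧ F a d

    γ ε : Carrier
    γ = d discount
    ε = eval ε-expr

    γ+Dε≈1 : γ + suc layers · ε ≈ 1#
    γ+Dε≈1 = begin
      γ + D · ε                           ≈⟨ +-congˡ D·ε≈1-γ ⟩
      γ + (1# - γ)                        ≈⟨ +-comm γ _ ⟩
      1# - γ + γ                          ≈⟨ x-y+y≈x 1# γ ⟩
      1#                                  ∎
      where
      open SetoidReasoning setoid
      D = suc layers
      num = eval (numeral D)
      num≉0 : ¬ num ≈ 0#
      -- As `num` is `1#` plus a nonnegative element, `num ≈ 0#` would give `1# ≤ 0#`.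
      num≉0 num≈0 = 0≉1 (antisym 0≤1 (≤-respʳ-≈ num≈0 (≤-respʳ-≈ (+-comm _ 1#)
        (≤-respʳ-≈ (+-congʳ (sym (reflexive (⟦numeral⟧ layers d)))) (y≤x+y 1# (·-nonneg layers 0≤1))))))
      D·ε≈1-γ : D · ε ≈ 1# - γ
      D·ε≈1-γ = begin
        D · ε                      ≈⟨ ·-cong (*-identityˡ ε) ⟨
        D · (1# * ε)               ≈⟨ ×-assoc-* D 1# ε ⟨
        (D · 1#) * ε               ≡⟨ ≡.cong (_* ε) (⟦numeral⟧ D d) ⟨
        num * ((1# - γ) * num ⁻¹)  ≈⟨ x∙yz≈y∙xz num (1# - γ) (num ⁻¹) ⟩
        (1# - γ) * (num * num ⁻¹)  ≈⟨ *-congˡ (⁻¹-inverseʳ num num≉0) ⟩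
        (1# - γ) * 1#              ≈⟨ *-identityʳ _ ⟩
        1# - γ                     ∎
        where
        ·-cong : ∀ {x y} → x ≈ y → D · x ≈ D · y
        ·-cong = MonoidMult.×-congʳ +-monoid D

    open SlowDiscount (totalActions S) discount≥0 discount<1 γ+Dε≈1

    q : Fin layers → Carrier
    q l = eval (follow-expr l)

    q≈ : ∀ l → q l ≈ γ * w ^ suc (toℕ l)
    q≈ l = reflexive (≡.cong (γ *_) (⟦^⟧ w-expr (suc (toℕ l)) d))

    0≤q : ∀ l → 0# ≤ q l
    0≤q l = ≤-respʳ-≈ (sym (q≈ l)) (*-nonneg discount≥0 (^-nonneg (suc (toℕ l)) 0≤w))

    q≤1 : ∀ l → q l ≤ 1#
    q≤1 l = ≤-respˡ-≈ (sym (q≈ l)) (γw^m≤1 (ℕ.m≤n⇒m≤1+n (Fin.toℕ<n l)))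

    -- One of the `l + 1` factors `w` in `q l` pays for the discount of the taking step itself; the
    -- other `l` match the scaling of the reward.
    gq≈w^lγ : ∀ l → g * q l ≈ w ^ toℕ l * γ
    gq≈w^lγ l = begin
      g * q l                    ≈⟨ *-congˡ (q≈ l) ⟩
      g * (γ * (w * w ^ toℕ l))  ≈⟨ x∙yz≈y∙xz g γ _ ⟩
      γ * (g * (w * w ^ toℕ l))  ≈⟨ *-congˡ (*-assoc g w _) ⟨
      γ * (g * w * w ^ toℕ l)    ≈⟨ *-congˡ (trans (*-congʳ g*w≈1) (*-identityˡ _)) ⟩
      γ * w ^ toℕ l              ≈⟨ *-comm γ _ ⟩
      w ^ toℕ l * γ              ∎
      where open SetoidReasoning setoid

    expectation : Move → (Fin size → Carrier) → Carrier
    expectation m f = sum (λ y → eval (probability-expr m y) * f y)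

    expectation-pass : ∀ x f → expectation (pass x) f ≈ f (encode x)
    expectation-pass x f = sum-point d (encode x) f

    -- The sum splits into the sink, the entry layer and the later layers, and the later layers have
    -- probability zero.
    expectation-take : ∀ l j f → expectation (take l j) f ≈
      (1# - q l) * f (encode sink) +
      q l * sum (λ k → d (probability j (clamp j l) k) * f (encode (place zero k)))
    expectation-take l j f = +-congˡ (begin
      sum h                                        ≈⟨ sum-++ (states S) h ⟩
      sum (λ k → h (k ↑ˡ rest)) + sum (λ y → h (states S ↑ʳ y))
                                                   ≈⟨ +-cong entry-layer other-layers ⟩
      q l * sum (λ k → p k * f (encode (place zero k))) + 0#
                                                   ≈⟨ +-identityʳ _ ⟩
      q l * sum (λ k → p k * f (encode (place zero k))) ∎)
      where
      open SetoidReasoning setoid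
      rest : ℕ
      rest = totalActions S ℕ.* states S
      p : Fin (states S) → Carrier
      p k = d (probability j (clamp j l) k)
      h : Fin (layers ℕ.* states S) → Carrier
      h y = eval (take-expr l j (decode (suc y))) * f (suc y)
      entry-layer : sum (λ k → h (k ↑ˡ rest)) ≈ q l * sum (λ k → p k * f (encode (place zero k)))
      entry-layer = trans
        (sum-cong-≋ λ k → trans
          (*-congʳ (reflexive (≡.cong (eval ∘ take-expr l j) (decode-encode (place zero k)))))
          (*-assoc (q l) (p k) _))
        (sym (*-distribˡ-sum (q l) (λ k → p k * f (encode (place zero k)))))
      later : ∀ y → eval (take-expr l j (decode (suc (states S ↑ʳ y)))) ≡ 0#
      later y rewrite Fin.splitAt-↑ʳ (states S) rest y = ≡.refl
      other-layers : sum (λ y → h (states S ↑ʳ y)) ≈ 0#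
      other-layers = trans (sum-cong-≋ λ y → *-congʳ (reflexive (later y)))
        (sum-0* (λ y → f (suc (states S ↑ʳ y))))

    isDiscountedMDP : IsDiscountedMDP target e
    isDiscountedMDP = record
      { discount≥0      = ≤-respʳ-≈ (sym e-discount) 0≤g
      ; discount<1      = ≤-respˡ-≈ (sym e-discount) (proj₁ g<1) , λ e≈1 → proj₂ g<1 (trans (sym e-discount) e≈1)
      ; probability≥0   = nonneg
      ; probability≤1   = λ x a y → ≤-respʳ-≈ (total-1 x a) (nonneg-term≤sum (nonneg x a) y)
      ; probability-sum = total-1
      }
      where
      e-discount : e discount ≈ g
      e-discount = reflexive (e≡ discount)
      move-nonneg : ∀ m y → 0# ≤ eval (probability-expr m y)
      move-nonneg (pass x) y with does (encode x Fin.≟ y)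
      ... | true  = 0≤1
      ... | false = ≤-refl
      move-nonneg (take l j) y with decode y
      ... | sink            = x≤y⇒0≤y-x (q≤1 l)
      ... | place zero k    = *-nonneg (0≤q l) (probability≥0 j (clamp j l) k)
      ... | place (suc _) k = ≤-refl
      nonneg : ∀ x a y → 0# ≤ e (probability x a y)
      nonneg x a y = ≤-respʳ-≈ (sym (reflexive (e≡ (probability x a y)))) (move-nonneg (move (decode x) a) y)
      -- The sum of a row of probabilities is treated as the expectation of the constant `1#`.
      expectation-1 : ∀ m → expectation m (λ _ → 1#) ≈ 1#
      expectation-1 (pass x)   = expectation-pass x (λ _ → 1#)
      expectation-1 (take l j) = begin
        expectation (take l j) (λ _ → 1#)       ≈⟨ expectation-take l j (λ _ → 1#) ⟩
        (1# - q l) * 1# + q l * sum (λ k → p k * 1#)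
          ≈⟨ +-cong (*-identityʳ _) (*-congˡ (trans (sum-cong-≋ λ k → *-identityʳ (p k)) (probability-sum j (clamp j l)))) ⟩
        1# - q l + q l * 1#                     ≈⟨ +-congˡ (*-identityʳ (q l)) ⟩
        1# - q l + q l                          ≈⟨ x-y+y≈x 1# (q l) ⟩
        1#                                      ∎
        where
        open SetoidReasoning setoid
        p : Fin (states S) → Carrier
        p k = d (probability j (clamp j l) k)
      total-1 : ∀ x a → sum (λ y → e (probability x a y)) ≈ 1#
      total-1 x a = trans
        (sum-cong-≋ λ y → trans (reflexive (e≡ (probability x a y))) (sym (*-identityʳ _)))
        (expectation-1 (move (decode x) a))

    moveValue : (Fin size → Carrier) → Move → Carrier
    moveValue u m = eval (reward-expr m) + g * expectation m u

    actionValue≈moveValue : ∀ u x a → actionValue target e u (encode x) a ≈ moveValue u (move x a)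
    actionValue≈moveValue u x a = trans
      (+-cong (reflexive (e≡ _)) (*-cong (reflexive (e≡ discount))
        (sum-cong-≋ λ y → *-congʳ {u y} (reflexive (e≡ (probability (encode x) a y))))))
      (reflexive (≡.cong (λ x → moveValue u (move x a)) (decode-encode x)))

    moveValue-pass : ∀ u x → moveValue u (pass x) ≈ g * u (encode x)
    moveValue-pass u x = trans (+-identityˡ _) (*-congˡ (expectation-pass x u))

    -- The mass sent to the sink contributes nothing, and reward and future share the factor
    -- `w ^ toℕ l`.
    moveValue-take : ∀ u → u (encode sink) ≈ 0# → ∀ l j → moveValue u (take l j) ≈
      w ^ toℕ l * actionValue S d (λ k → u (encode (place zero k))) j (clamp j l)
    moveValue-take u u-sink≈0 l j = begin
      eval (w-expr `^ toℕ l) * r + g * expectation (take l j) u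
        ≈⟨ +-cong (*-congʳ (reflexive (⟦^⟧ w-expr (toℕ l) d))) (*-congˡ take≈) ⟩
      w ^ toℕ l * r + g * (q l * Σpu)           ≈⟨ +-congˡ (*-assoc g (q l) Σpu) ⟨
      w ^ toℕ l * r + g * q l * Σpu             ≈⟨ +-congˡ (*-congʳ (gq≈w^lγ l)) ⟩
      w ^ toℕ l * r + w ^ toℕ l * γ * Σpu       ≈⟨ +-congˡ (*-assoc _ γ Σpu) ⟩
      w ^ toℕ l * r + w ^ toℕ l * (γ * Σpu)     ≈⟨ distribˡ _ r _ ⟨
      w ^ toℕ l * (r + γ * Σpu)                 ∎
      where
      open SetoidReasoning setoid
      r Σpu : Carrier
      r   = d (reward j (clamp j l))
      Σpu = sum (λ k → d (probability j (clamp j l) k) * u (encode (place zero k)))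
      take≈ : expectation (take l j) u ≈ q l * Σpu
      take≈ = trans (expectation-take l j u)
        (trans (+-congʳ (trans (*-congˡ u-sink≈0) (zeroʳ _))) (+-identityˡ _))

    module _ (σ : Policy target) (optimal : IsOptimal target e σ) where
      open IsOptimal optimal renaming (v* to u)

      -- The value `u` is attained by some action, which the optimal choice of `σ` dominates; the
      -- Bellman inequality gives the converse.
      u≈ : ∀ x → u (encode x) ≈ moveValue u (move x (σ (encode x)))
      u≈ x = trans
        (antisym (≤-respˡ-≈ (sym (proj₂ (proj₁ (bellman (encode x))))) (proj₂ (attains (encode x)) _))
                 (proj₂ (bellman (encode x)) _))
        (actionValue≈moveValue u x _)

      ≤u : ∀ x a → moveValue u (move x a) ≤ u (encode x)
      ≤u x a = ≤-respˡ-≈ (actionValue≈moveValue u x a) (proj₂ (bellman (encode x)) a)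

      u-sink≈0 : u (encode sink) ≈ 0#
      u-sink≈0 = fixedPoint≈0 (trans (u≈ sink) (moveValue-pass u sink))

      v : Fin (states S) → Carrier
      v k = u (encode (place zero k))

      chain stop : Fin (states S) → Fin layers → Carrier
      chain j l = u (encode (place l j))
      stop j l  = w ^ toℕ l * actionValue S d v j (clamp j l)

      moveValue≈chainValue : ∀ j l a → moveValue u (move (place l j) a) ≈ chainValue g (stop j) (chain j) l a
      moveValue≈chainValue j l zero       = moveValue-take u u-sink≈0 l j
      moveValue≈chainValue j l (suc zero) = trans
        (reflexive (onward-natural (moveValue u) (take l j) (λ l′ → pass (place l′ j)) l))
        (onward-cong (moveValue-take u u-sink≈0 l j) (λ l′ → moveValue-pass u (place l′ j)) l)

      follows : Fin (states S) → Fin layers → Fin 2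
      follows j l = decision target σ (toℕ (encode (place l j)))

      recovered : Policy S
      recovered j = clamp j (stopAt (follows j))

      -- Following `σ` through the chain of `j` ends at the recovered action, where discount and
      -- scaling cancel.
      v≈ : ∀ j → v j ≈ actionValue S d v j (recovered j)
      v≈ j = trans
        (stopAt-value 0≤g (follows j) λ l → trans (u≈ (place l j))
          (trans (moveValue≈chainValue j l _)
            (reflexive (≡.cong (chainValue g (stop j) (chain j) l)
              (≡.sym (decision-target S σ (encode (place l j))))))))
        (g^k*w^k*x≈x (toℕ (stopAt (follows j))) _)

      -- Action `i` sits at some place `l`; passing up to there and taking it is worth exactly its
      -- original value.
      actionValue≤v : ∀ j i → actionValue S d v j i ≤ v j
      actionValue≤v j i with l , ≡.refl ← clamp-surjective j i =
        ≤-respˡ-≈ (g^k*w^k*x≈x (toℕ l) _)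
          (stop-≤ 0≤g (λ l a → ≤-respˡ-≈ (moveValue≈chainValue j l a) (≤u (place l j) a)) l)

      recovered-optimal : IsOptimal S d recovered
      recovered-optimal = record
        { v*      = v
        ; bellman = λ j → (recovered j , v≈ j) , actionValue≤v j
        ; attains = λ j → (recovered j , refl) , λ i → ≤-respʳ-≈ (v≈ j) (actionValue≤v j i)
        }

  run-transform : ∀ S d → ∃ λ e → Semantics.run F (transform S) d ≡ (Gadget.target S , e) ×
                  (∀ x → e x ≡ ⟦_⟧ F (Gadget.entry-expr S x) d)
  run-transform S d
    using (e , run≡ , e≡) ← run-tabulate F d (Gadget.entry-expr S ∘ Gadget.entryAt S) (Gadget.target S) (Gadget.index S)
    = e , run≡ , λ x → ≡.trans (e≡ x) (≡.cong (λ y → ⟦_⟧ F (Gadget.entry-expr S y) d) (Gadget.entryAt-index S x))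

  reduction : ∀ S d → IsDiscountedMDP S d → BinaryReduction F transform recover output-poly S d
  reduction S d isMDP using (e , run≡ , e≡) ← run-transform S d = record
    { isDiscountedMDP = back (λ (T , e) → IsDiscountedMDP T e) (isDiscountedMDP e e≡)
    ; isBinary        = back (λ (T , _) → IsBinary T) (λ _ → ℕ.≤-refl)
    ; outputSize      = back (λ (T , _) → states T ℕ.+ totalActions T ℕ.≤ output-poly at S)
                          (ℕ.≤-reflexive (output-size S))
    ; recovers        = back (λ (T , e) → ∀ σ → IsOptimal T e σ →
                                IsOptimal S d (proj₁ (run (recover S T σ) d)))
                          (recovered-optimal e e≡)
    }
    where
    open Semantics F
    open Correctness S d isMDP
    -- Shape and data are transported together, since the type of the data, like that of the
    -- policies, depends on the shape.
    back : ∀ {p} (P : Σ Shape (λ T → Entry T → Carrier) → Set p) →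
           P (Gadget.target S , proj₁ (run-transform S d)) → P (run (transform S) d)
    back P = ≡.subst P (≡.sym (proj₁ (proj₂ (run-transform S d))))

open import Data.Nat using (_≤_)

corollary9p3 : ∀ (c ℓ₁ ℓ₂ : Level) →
    Σ[ transform ∈ Transformation ] Σ[ recover ∈ Recovery ]
    (∃[ P ] (∀ S → operations (transform S) ≤ P at S))
    × (∃[ Q ] (∀ S T (σ : Policy T) → operations (recover S T σ) ≤ Q at S))
    × (∃[ B ] (∀ (F : OrderedField c ℓ₁ ℓ₂) (S : Shape)
    (d : Entry S → OrderedField.Carrier F) →
    MDP.IsDiscountedMDP F S d →
    BinaryReduction F transform recover B S d))
corollary9p3 c ℓ₁ ℓ₂ = transform , recover ,
  (operations-poly , transform-cheap) ,
  (con 0 , λ S T σ → z≤n) ,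
  (output-poly , reduction)
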